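{- Suppose $G$ and $H$ are two graphs with adjacency matrices $\mathbf A_G$ and $\mathbf A_H$. Then $\mathrm{CDC}(G)\simeq\mathrm{CDC}(H)$ if and only if there exist two permutation matrices $\mathbf Q$ and $\mathbf R$ such that $\mathbf Q\,\mathbf A_G\,\mathbf R=\mathbf A_H$.
   Context: All graphs are finite, simple and undirected (no loops or multiple edges), with vertex set $\mathcal V=\{1,\dots,n\}$ and edge set $\mathcal E$. The adjacency matrix of $G$ is the symmetric $n\times n$ $(0,1)$-matrix with $(i,j)$ entry $1$ iff $\{i,j\}\in\mathcal E$. The canonical double covering $\mathrm{CDC}(G)$ of $G=(\mathcal V,\mathcal E)$ is the graph with vertex set $\mathcal V\times\{0,1\}$ and edge set $\{\{(u,0),(v,1)\},\{(u,1),(v,0)\} : \{u,v\}\in\mathcal E\}$. $\simeq$ denotes graph isomorphism. The permutation matrices $\mathbf Q$ and $\mathbf R$ are not required to be inverse to each other. -}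

module Defs where

open import Level using (0ℓ)
open import Data.Nat.Base using (ℕ)
open import Data.Integer.Base using (ℤ; 0ℤ; 1ℤ; _*_)
open import Data.Integer.Properties using (+-0-commutativeMonoid)
open import Data.Fin.Base using (Fin; cast)
open import Data.Fin.Patterns using (0F; 1F)
open import Data.Product using (Σ-syntax; _×_; _,_; ∃!)
open import Data.Sum.Base using (_⊎_)
open import Data.Bool.Base using (if_then_else_)
open import Function.Bundles using (_↔_; _⇔_; Inverse)
open import Relation.Nullary.Decidable using (no; does; map′)
open import Relation.Binary.Core using (Rel)
open import Relation.Binary.Definitions using (Symmetric; Irreflexive; Decidable)
open import Relation.Binary.PropositionalEquality.Core using (_≡_; refl)
open import Algebra.Properties.CommutativeMonoid.Sum +-0-commutativeMonoid using (sum)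

-- Simple undirected graphs on the vertex set V.  Edges {u , v} are encoded by
-- the symmetric irreflexive relation Adj.  Decidability is part of what it
-- means for the edge set of a finite graph to be given.
record Graph (V : Set) : Set₁ where
  field
    Adj    : Rel V 0ℓ
    sym    : Symmetric Adj
    irrefl : Irreflexive _≡_ Adj
    adj?   : Decidable Adj

infix 4 _≃_

record _≃_ {V W : Set} (G : Graph V) (H : Graph W) : Set where
  private
    module G = Graph G
    module H = Graph H
  field
    bijection : V ↔ W
  open Inverse bijection using (to)
  field
    adj⇔ : ∀ u v → G.Adj u v ⇔ H.Adj (to u) (to v)

module _ {V : Set} (G : Graph V) where
  private
    module G = Graph G

  data CDCAdj : Rel (V × Fin 2) 0ℓ where
    edge₀₁ : ∀ {u v} → G.Adj u v → CDCAdj (u , 0F) (v , 1F)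
    edge₁₀ : ∀ {u v} → G.Adj u v → CDCAdj (u , 1F) (v , 0F)

  private
    cdc-sym : Symmetric CDCAdj
    cdc-sym (edge₀₁ e) = edge₁₀ (G.sym e)
    cdc-sym (edge₁₀ e) = edge₀₁ (G.sym e)

    cdc-irrefl : Irreflexive _≡_ CDCAdj
    cdc-irrefl refl ()

    cdc-adj? : Decidable CDCAdj
    cdc-adj? (u , 0F) (v , 0F) = no λ ()
    cdc-adj? (u , 0F) (v , 1F) = map′ edge₀₁ (λ { (edge₀₁ e) → e }) (G.adj? u v)
    cdc-adj? (u , 1F) (v , 0F) = map′ edge₁₀ (λ { (edge₁₀ e) → e }) (G.adj? u v)
    cdc-adj? (u , 1F) (v , 1F) = no λ ()

  CDC : Graph (V × Fin 2)
  CDC = record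
    { Adj    = CDCAdj
    ; sym    = cdc-sym
    ; irrefl = cdc-irrefl
    ; adj?   = cdc-adj?
    }

Matrix : ℕ → ℕ → Set
Matrix m n = Fin m → Fin n → ℤ

infixl 7 _⊗_

_⊗_ : ∀ {l m n} → Matrix l m → Matrix m n → Matrix l n
(A ⊗ B) i k = sum λ j → A i j * B j k

infix 4 _≐_

-- Equality of matrices whose sizes are not known in advance to agree: the
-- sizes must be equal, and then all corresponding entries.
_≐_ : ∀ {m n m′ n′} → Matrix m n → Matrix m′ n′ → Set
_≐_ {m} {n} {m′} {n′} A B =
  Σ[ p ∈ m ≡ m′ ] Σ[ q ∈ n ≡ n′ ] (∀ i j → A i j ≡ B (cast p i) (cast q j))

adjacencyMatrix : ∀ {n} → Graph (Fin n) → Matrix n n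
adjacencyMatrix G i j = if does (Graph.adj? G i j) then 1ℤ else 0ℤ

record IsPermutationMatrix {n} (P : Matrix n n) : Set where
  field
    zero-one : ∀ i j → P i j ≡ 0ℤ ⊎ P i j ≡ 1ℤ
    row      : ∀ i → ∃! _≡_ λ j → P i j ≡ 1ℤ
    column   : ∀ j → ∃! _≡_ λ i → P i j ≡ 1ℤ

{-# OPTIONS --safe #-}

-- An isomorphism φ : CDC(G) ≃ CDC(H) that respects the two layers is a pair of bijections σ, τ
-- with u ~ v in G iff σ u ~ τ v in H, that is, a pair of permutation matrices as required.  The point
-- is to make an arbitrary φ respect the layers.  CDC(G) carries two proper 2-colourings, its own
-- layers and those of H seen through φ, each reversed by an involutive automorphism s, respectively t.
-- Call a vertex bad if the colourings disagree there.  From a bad vertex x apply s, t, s, … in turn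
-- until the next bad vertex f x: then the second colour of f x is the first colour of x.  The word
-- leading from x to f x depends only on the component of x, so f respects adjacency.  If the walk from
-- x arrives by s, then walking back shows f (f x) = x; exchanging all such x with f x is an
-- automorphism, and composing φ with it leaves fewer bad vertices.  If every walk arrives by t, then f
-- permutes the bad vertices, and composing φ with f makes the colourings agree.

module Submission where

open import Defs
import Data.Integer.Properties as ℤ
open import Algebra.Properties.CommutativeMonoid.Sum ℤ.+-0-commutativeMonoid
  using (sum; sum-remove; sum-cong-≗; sum-replicate-zero)
open import Data.Bool.Base using (true; false; if_then_else_)
open import Data.Fin.Base using (Fin; zero; suc; toℕ; opposite; punchIn)
open import Data.Fin.Patterns using (0F; 1F)
open import Data.Fin.Permutation using (↔⇒≡)
open import Data.Fin.Properties
  using (_≟_; any?; pigeonhole; opposite-involutive; cast-is-id; punchInᵢ≢i; *↔×)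
open import Data.Fin.Subset using (Subset; _∈_; _⊂_)
open import Data.Fin.Subset.Induction using (⊂-wellFounded)
open import Data.Integer.Base using (ℤ; 0ℤ; 1ℤ; _+_; _*_)
open import Data.Nat.Base as ℕ using (ℕ; zero; suc)
open import Data.Nat.GeneralisedArithmetic using (fold; iterate; iterate-is-fold)
import Data.Nat.Properties as ℕ
open import Data.Product.Base using (Σ-syntax; ∃; ∃-syntax; _×_; _,_; proj₁; proj₂)
open import Data.Product.Function.NonDependent.Propositional using (_×-↔_)
open import Data.Sum.Base using (_⊎_; inj₁; inj₂)
open import Data.Vec.Base using (tabulate)
open import Data.Vec.Properties using (lookup∘tabulate; lookup⇒[]=; []=⇒lookup)
open import Function.Base using (_∘_; _$_; case_of_)
open import Function.Bundles
  using (_↔_; _⇔_; _↣_; Inverse; Equivalence; Injection; mk↔ₛ′; mk⇔)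
open import Function.Construct.Composition using (_↔-∘_; _⇔-∘_)
open import Function.Construct.Identity using (↔-id)
open import Function.Construct.Symmetry using (↔-sym; ⇔-sym)
open import Function.Definitions using (Injective)
open import Function.Properties.Inverse using (↔⇒↣)
open import Induction.WellFounded using (Acc; acc)
open import Relation.Binary.PropositionalEquality
  using (_≡_; _≢_; refl; sym; trans; cong; cong₂; subst; subst₂; module ≡-Reasoning)
open import Relation.Nullary.Decidable
  using (Dec; yes; no; does; ¬?; dec-true; does-⇔; decidable-stable)
open import Relation.Nullary.Negation using (¬_; contradiction)

open Inverse using (to; from; strictlyInverseˡ; strictlyInverseʳ)

-- Two-valued colours and injective self-maps of finite sets.

↔-injective : {A B : Set} (π : A ↔ B) → Injective _≡_ _≡_ (to π)
↔-injective π = Injection.injective (↔⇒↣ π)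

does⇒ : {A : Set} (a? : Dec A) → does a? ≡ true → A
does⇒ (yes a) _ = a

≢⇒≡opposite : {i j : Fin 2} → i ≢ j → i ≡ opposite j
≢⇒≡opposite {0F} {0F} i≢j = contradiction refl i≢j
≢⇒≡opposite {0F} {1F} _   = refl
≢⇒≡opposite {1F} {0F} _   = refl
≢⇒≡opposite {1F} {1F} i≢j = contradiction refl i≢j

opposite-injective : ∀ {n} {i j : Fin n} → opposite i ≡ opposite j → i ≡ j
opposite-injective {i = i} {j} eq =
  trans (sym (opposite-involutive i)) (trans (cong opposite eq) (opposite-involutive j))

fold-cancel : {A : Set} {f : A → A} → Injective _≡_ _≡_ f →
              ∀ x m {n} → fold x f m ≡ fold x f (m ℕ.+ n) → x ≡ fold x f n
fold-cancel inj x zero    eq = eq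
fold-cancel inj x (suc m) eq = fold-cancel inj x m (inj eq)

-- By the pigeonhole principle two of the iterates with exponents 0 to `n` coincide; injectivity
-- strips off the common initial iterations.
injective⇒periodic : {A : Set} {n : ℕ} → A ↣ Fin n → {f : A → A} → Injective _≡_ _≡_ f →
                     ∀ x → ∃[ k ] x ≡ fold x f (suc k)
injective⇒periodic {n = n} A↣Fin {f} inj x
  with i , j , i<j , eq ← pigeonhole (ℕ.n<1+n n) (λ i → Injection.to A↣Fin (fold x f (toℕ i)))
  with k , 1+i+k≡j ← ℕ.m≤n⇒∃[o]m+o≡n i<j
  = k , fold-cancel inj x (toℕ i)
          (trans (Injection.injective A↣Fin eq)
                 (cong (fold x f) (trans (sym 1+i+k≡j) (sym (ℕ.+-suc (toℕ i) k)))))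

-- If `suc k` applications of `f` fix `y`, then `k` applications give a preimage of `y`.
injective⇒↔ : {A : Set} {n : ℕ} → A ↣ Fin n → (f : A → A) → Injective _≡_ _≡_ f → A ↔ A
injective⇒↔ A↣Fin f inj = mk↔ₛ′ f f⁻¹ f-f⁻¹ λ x → inj (f-f⁻¹ (f x))
  where
  f⁻¹ : _ → _
  f⁻¹ y = fold y f (proj₁ (injective⇒periodic A↣Fin inj y))

  f-f⁻¹ : ∀ y → f (f⁻¹ y) ≡ y
  f-f⁻¹ y = sym (proj₂ (injective⇒periodic A↣Fin inj y))

-- Isomorphisms and cover structures.

≃-sym : {V W : Set} {G : Graph V} {H : Graph W} → G ≃ H → H ≃ G
≃-sym {G = G} {H} φ = record
  { bijection = ↔-sym φ.bijection
  ; adj⇔      = λ u v → ⇔-sym $ subst₂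
      (λ a b → Graph.Adj G (from φ.bijection u) (from φ.bijection v) ⇔ Graph.Adj H a b)
      (strictlyInverseˡ φ.bijection u) (strictlyInverseˡ φ.bijection v) (φ.adj⇔ _ _)
  }
  where module φ = _≃_ φ

≃-trans : {U V W : Set} {F : Graph U} {G : Graph V} {H : Graph W} → F ≃ G → G ≃ H → F ≃ H
≃-trans φ ψ = record
  { bijection = ψ.bijection ↔-∘ φ.bijection
  ; adj⇔      = λ u v → ψ.adj⇔ _ _ ⇔-∘ φ.adj⇔ u v
  }
  where
  module φ = _≃_ φ
  module ψ = _≃_ ψ

-- What makes a graph the canonical double covering of its quotient by swap (up to loops).
record CoverStructure {X : Set} (Γ : Graph X) : Set where
  open Graph Γ using (Adj)
  field
    side            : X → Fin 2
    swap            : X → X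
    side-proper     : ∀ {x y} → Adj x y → side y ≡ opposite (side x)
    swap-involutive : ∀ x → swap (swap x) ≡ x
    swap-adj        : ∀ {x y} → Adj x y → Adj (swap x) (swap y)
    side-swap       : ∀ x → side (swap x) ≡ opposite (side x)

pullback : {X Y : Set} {Γ : Graph X} {Δ : Graph Y} → Γ ≃ Δ → CoverStructure Δ → CoverStructure Γ
pullback φ S = record
  { side            = S.side ∘ f
  ; swap            = g ∘ S.swap ∘ f
  ; side-proper     = S.side-proper ∘ Equivalence.to (φ.adj⇔ _ _)
  ; swap-involutive = λ x → trans (cong (g ∘ S.swap) (fg _))
                              (trans (cong g (S.swap-involutive (f x))) (gf x))
  ; swap-adj        = Equivalence.to (φ⁻¹.adj⇔ _ _) ∘ S.swap-adj ∘ Equivalence.to (φ.adj⇔ _ _)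
  ; side-swap       = λ x → trans (cong S.side (fg _)) (S.side-swap (f x))
  }
  where
  module φ = _≃_ φ
  module φ⁻¹ = _≃_ (≃-sym φ)
  module S = CoverStructure S
  f = to φ.bijection
  g = from φ.bijection
  fg = strictlyInverseˡ φ.bijection
  gf = strictlyInverseʳ φ.bijection

-- Alternating walks between bad vertices.

module _ {X : Set} {N : ℕ} (enc : X ↔ Fin N) {Γ : Graph X} (S T : CoverStructure Γ) where
  private
    module Γ = Graph Γ
    module S = CoverStructure S
    module T = CoverStructure T

  Bad : X → Set
  Bad x = S.side x ≢ T.side x

  bad? : ∀ x → Dec (Bad x)
  bad? x = ¬? (S.side x ≟ T.side x)

  ¬bad⇒≡ : ∀ {x} → ¬ Bad x → S.side x ≡ T.side x
  ¬bad⇒≡ {x} = decidable-stable (S.side x ≟ T.side x)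

  -- Both colourings change along every edge, so badness is constant on connected components.
  bad-adj : ∀ {x y} → Γ.Adj x y → Bad x → Bad y
  bad-adj e bad eq =
    bad (opposite-injective (trans (sym (S.side-proper e)) (trans eq (T.side-proper e))))

  badSet : Subset N
  badSet = tabulate (does ∘ bad? ∘ from enc)

  ∈badSet⁺ : ∀ {i} → Bad (from enc i) → i ∈ badSet
  ∈badSet⁺ {i} bad = lookup⇒[]= i badSet (trans (lookup∘tabulate _ i) (dec-true (bad? _) bad))

  ∈badSet⁻ : ∀ {i} → i ∈ badSet → Bad (from enc i)
  ∈badSet⁻ {i} i∈ = does⇒ (bad? _) (trans (sym (lookup∘tabulate _ i)) ([]=⇒lookup i∈))

  flip : Fin 2 → X → X
  flip 0F = S.swap
  flip 1F = T.swap

  flip-involutive : ∀ e x → flip e (flip e x) ≡ x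
  flip-involutive 0F = S.swap-involutive
  flip-involutive 1F = T.swap-involutive

  flip-adj : ∀ e {x y} → Γ.Adj x y → Γ.Adj (flip e x) (flip e y)
  flip-adj 0F = S.swap-adj
  flip-adj 1F = T.swap-adj

  -- The second component tells which involution is applied next.
  State : Set
  State = X × Fin 2

  walk : State → State
  walk (x , e) = flip e x , opposite e

  reverse : State → State
  reverse (x , e) = x , opposite e

  walk-reverse-walk : ∀ p → walk (reverse (walk p)) ≡ reverse p
  walk-reverse-walk (x , e) rewrite opposite-involutive e = cong (_, opposite e) (flip-involutive e x)

  reverse-injective : Injective _≡_ _≡_ reverse
  reverse-injective {_ , i} {_ , j} eq = cong₂ _,_ (cong proj₁ eq) (opposite-injective (cong proj₂ eq))

  walk-injective : Injective _≡_ _≡_ walk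
  walk-injective {p} {q} eq = reverse-injective
    (trans (sym (walk-reverse-walk p)) (trans (cong (walk ∘ reverse) eq) (walk-reverse-walk q)))

  infix 4 _⟶_

  -- First return of `walk` to the bad vertices, after at least one step. Paths can be analysed by
  -- induction, while termination is left to `returns`.
  data _⟶_ (p : State) : State → Set where
    arrive   : Bad (proj₁ (walk p)) → p ⟶ walk p
    continue : ∀ {q} → ¬ Bad (proj₁ (walk p)) → walk p ⟶ q → p ⟶ q

  ⟶-bad : ∀ {p q} → p ⟶ q → Bad (proj₁ q)
  ⟶-bad (arrive bad)      = bad
  ⟶-bad (continue _ path) = ⟶-bad path

  ⟶-functional : ∀ {p q q′} → p ⟶ q → p ⟶ q′ → q ≡ q′
  ⟶-functional (arrive _)         (arrive _)          = refl
  ⟶-functional (arrive bad)       (continue ¬bad _)   = contradiction bad ¬bad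
  ⟶-functional (continue ¬bad _)  (arrive bad)        = contradiction bad ¬bad
  ⟶-functional (continue _ path)  (continue _ path′)  = ⟶-functional path path′

  -- Each step can be retraced by `walk-reverse-walk`. The vertices in between are good, and the
  -- retraced walk stops at the start because that vertex is bad.
  ⟶-reverse : ∀ {p q} → Bad (proj₁ p) → p ⟶ q → reverse q ⟶ reverse p
  ⟶-reverse {p} bad path = go path λ {o} eq → subst (o ⟶_) eq (arrive (subst (Bad ∘ proj₁) (sym eq) bad))
    where
    -- The first step becomes the last, hence an accumulator: it turns any state one step before
    -- `reverse p` into the start of a path to `r`.
    go : ∀ {p q r} → p ⟶ q → (∀ {o} → walk o ≡ reverse p → o ⟶ r) → reverse q ⟶ r
    go {p} (arrive _)           k = k (walk-reverse-walk p)
    go {p} (continue ¬bad path) k = go path λ eq →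
      continue (¬bad ∘ subst (Bad ∘ proj₁) eq) (subst (_⟶ _) (sym eq) (k (walk-reverse-walk p)))

  -- Both swaps preserve edges and adjacent vertices are bad together, so neighbours follow the same
  -- word of swaps and stop at the same time.
  ⟶-adj : ∀ {x x′ y e e′} → Γ.Adj x x′ → (x , e) ⟶ (y , e′) → ∃[ y′ ] (x′ , e) ⟶ (y′ , e′) × Γ.Adj y y′
  ⟶-adj {e = e} xx′ (arrive bad) = _ , arrive (bad-adj (flip-adj e xx′) bad) , flip-adj e xx′
  ⟶-adj {e = e} xx′ (continue ¬bad path)
    with y′ , path′ , yy′ ← ⟶-adj (flip-adj e xx′) path
    = y′ , continue (¬bad ∘ bad-adj (Γ.sym (flip-adj e xx′))) path′ , yy′

  State↣Fin : State ↣ Fin (N ℕ.* 2)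
  State↣Fin = ↔⇒↣ (↔-sym *↔× ↔-∘ (enc ×-↔ ↔-id (Fin 2)))

  findReturn : ∀ k p → Bad (proj₁ (iterate walk p (suc k))) → ∃ (p ⟶_)
  findReturn k p bad with bad? (proj₁ (walk p))
  findReturn k       p bad | yes bad′ = _ , arrive bad′
  findReturn zero    p bad | no ¬bad  = contradiction bad ¬bad
  findReturn (suc k) p bad | no ¬bad  with q , path ← findReturn k (walk p) bad = q , continue ¬bad path

  -- `walk` is injective on a finite set, so it comes back to `(x , e)`; as `x` is bad, the search
  -- ends there at the latest.
  returns : ∀ {x} e → Bad x → ∃ ((x , e) ⟶_)
  returns {x} e bad with k , eq ← injective⇒periodic State↣Fin walk-injective (x , e)
    = findReturn k (x , e) (subst (Bad ∘ proj₁) (trans eq (iterate-is-fold (x , e) walk (suc k))) bad)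

  -- Constant along the walk between bad vertices.
  label : State → Fin 2
  label (x , 0F) = S.side x
  label (x , 1F) = opposite (T.side x)

  -- At a bad vertex the two colours are opposite, which cancels the change made by `S.swap`; the
  -- change made by `T.swap` is built into `label`.
  side-walk : ∀ p → Bad (proj₁ (walk p)) → T.side (proj₁ (walk p)) ≡ label p
  side-walk (x , 0F) bad = opposite-injective (trans (sym (≢⇒≡opposite bad)) (S.side-swap x))
  side-walk (x , 1F) _   = T.side-swap x

  label-walk : ∀ p → ¬ Bad (proj₁ (walk p)) → label (walk p) ≡ label p
  label-walk (x , 0F) ¬bad = trans (cong opposite (trans (sym (¬bad⇒≡ ¬bad)) (S.side-swap x)))
                                   (opposite-involutive _)
  label-walk (x , 1F) ¬bad = trans (¬bad⇒≡ ¬bad) (T.side-swap x)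

  -- `label` survives every good vertex and becomes the second colour at the bad one. From a state
  -- with component `0F` it is the first colour of the start, as alignment requires.
  ⟶-side : ∀ {p q} → p ⟶ q → T.side (proj₁ q) ≡ label p
  ⟶-side {p} (arrive bad)         = side-walk p bad
  ⟶-side {p} (continue ¬bad path) = trans (⟶-side path) (label-walk p ¬bad)

  -- The automorphism exchanging bad vertices that meet.

  Meets : X → X → Set
  Meets x y = Bad x × (x , 0F) ⟶ (y , 1F)

  meets? : ∀ x → Dec (∃ (Meets x))
  meets? x with bad? x
  ... | no ¬bad = no λ (_ , bad , _) → ¬bad bad
  ... | yes bad with returns 0F bad
  ...   | (y , 1F) , path = yes (y , bad , path)
  ...   | (_ , 0F) , path = no λ (_ , _ , path′) → case ⟶-functional path path′ of λ ()

  -- Arrival with component `1F` means that `S.swap` was applied last. It was also applied first, so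
  -- the word is a palindrome and the reversed path has the same form.
  Meets-sym : ∀ {x y} → Meets x y → Meets y x
  Meets-sym (bad , path) = ⟶-bad path , ⟶-reverse bad path

  Meets-functional : ∀ {x y z} → Meets x y → Meets x z → y ≡ z
  Meets-functional (_ , path) (_ , path′) = cong proj₁ (⟶-functional path path′)

  Meets-adj : ∀ {x x′ y} → Γ.Adj x x′ → Meets x y → ∃[ y′ ] Meets x′ y′ × Γ.Adj y y′
  Meets-adj xx′ (bad , path) with y′ , path′ , yy′ ← ⟶-adj xx′ path
    = y′ , (bad-adj xx′ bad , path′) , yy′

  exchange : X → X
  exchange x with meets? x
  ... | yes (y , _) = y
  ... | no _        = x

  exchange-Meets : ∀ {x y} → Meets x y → exchange x ≡ y
  exchange-Meets {x} {y} m with meets? x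
  ... | yes (_ , m′) = Meets-functional m′ m
  ... | no ¬m        = contradiction (y , m) ¬m

  exchange-¬Meets : ∀ {x} → ¬ ∃ (Meets x) → exchange x ≡ x
  exchange-¬Meets {x} ¬m with meets? x
  ... | yes m = contradiction m ¬m
  ... | no _  = refl

  exchange-involutive : ∀ x → exchange (exchange x) ≡ x
  exchange-involutive x = case meets? x of λ where
    (yes (y , m)) → trans (cong exchange (exchange-Meets m)) (exchange-Meets (Meets-sym m))
    (no ¬m)       → trans (cong exchange (exchange-¬Meets ¬m)) (exchange-¬Meets ¬m)

  exchange-adj : ∀ {x y} → Γ.Adj x y → Γ.Adj (exchange x) (exchange y)
  exchange-adj {x} {y} xy = case meets? x of λ where
    (yes (_ , m)) → let _ , m′ , x′y′ = Meets-adj xy m in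
                    subst₂ Γ.Adj (sym (exchange-Meets m)) (sym (exchange-Meets m′)) x′y′
    -- If `y` met a vertex, so would `x`, by the reversed edge; hence both ends are fixed.
    (no ¬m)       → let ¬m′ = λ (_ , m′) → let _ , m , _ = Meets-adj (Γ.sym xy) m′ in ¬m (_ , m) in
                    subst₂ Γ.Adj (sym (exchange-¬Meets ¬m)) (sym (exchange-¬Meets ¬m′)) xy

  exchangeAutomorphism : Γ ≃ Γ
  exchangeAutomorphism = record
    { bijection = mk↔ₛ′ exchange exchange exchange-involutive exchange-involutive
    ; adj⇔      = λ x y → mk⇔ exchange-adj
        (subst₂ Γ.Adj (exchange-involutive x) (exchange-involutive y) ∘ exchange-adj)
    }

  -- The automorphism advancing every bad vertex.

  module _ (¬meets : ∀ {x} → ¬ ∃ (Meets x)) where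

    next : ∀ {x} → Bad x → ∃[ y ] (x , 0F) ⟶ (y , 0F)
    next bad with returns 0F bad
    ... | (y , 0F) , path = y , path
    ... | (y , 1F) , path = contradiction (y , bad , path) ¬meets

    -- The graph of the advancing map, so that proofs match on paths rather than on the decision
    -- inside `advance`.
    data Advance (x : X) : X → Set where
      move : ∀ {y} → Bad x → (x , 0F) ⟶ (y , 0F) → Advance x y
      stay : ¬ Bad x → Advance x x

    advance : ∀ x → ∃ (Advance x)
    advance x with bad? x
    ... | yes bad with y , path ← next bad = y , move bad path
    ... | no ¬bad = x , stay ¬bad

    Advance-functional : ∀ {x y z} → Advance x y → Advance x z → y ≡ z
    Advance-functional (move _ path) (move _ path′) = cong proj₁ (⟶-functional path path′)
    Advance-functional (move bad _)  (stay ¬bad)    = contradiction bad ¬bad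
    Advance-functional (stay ¬bad)   (move bad _)   = contradiction bad ¬bad
    Advance-functional (stay _)      (stay _)       = refl

    -- Reversed paths from a bad `z` all start at `(z , 1F)`, so determinism makes them end alike.
    -- In the mixed cases `z` would be both bad and good.
    Advance-injective : ∀ {x y z} → Advance x z → Advance y z → x ≡ y
    Advance-injective (move bad path) (move bad′ path′) =
      cong proj₁ (⟶-functional (⟶-reverse bad path) (⟶-reverse bad′ path′))
    Advance-injective (move _ path) (stay ¬bad)   = contradiction (⟶-bad path) ¬bad
    Advance-injective (stay ¬bad)   (move _ path) = contradiction (⟶-bad path) ¬bad
    Advance-injective (stay _)      (stay _)      = refl

    Advance-adj : ∀ {x x′ y} → Γ.Adj x x′ → Advance x y → ∃[ y′ ] Advance x′ y′ × Γ.Adj y y′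
    Advance-adj xx′ (move bad path) with y′ , path′ , yy′ ← ⟶-adj xx′ path
      = y′ , move (bad-adj xx′ bad) path′ , yy′
    Advance-adj xx′ (stay ¬bad) = _ , stay (¬bad ∘ bad-adj (Γ.sym xx′)) , xx′

    -- The reversed path carries the edge back to one from `x` to a vertex that determinism
    -- identifies with `x′`.
    Advance-adj⁻¹ : ∀ {x y y′} → Γ.Adj y y′ → Advance x y → ∀ {x′} → Advance x′ y′ → Γ.Adj x x′
    Advance-adj⁻¹ yy′ (move bad path) (move bad′ path′)
      with _ , path″ , xx″ ← ⟶-adj yy′ (⟶-reverse bad path)
      = subst (Γ.Adj _) (cong proj₁ (⟶-functional path″ (⟶-reverse bad′ path′))) xx″
    Advance-adj⁻¹ yy′ (move _ path) (stay ¬bad)   = contradiction (bad-adj yy′ (⟶-bad path)) ¬bad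
    Advance-adj⁻¹ yy′ (stay ¬bad)   (move _ path) = contradiction (bad-adj (Γ.sym yy′) (⟶-bad path)) ¬bad
    Advance-adj⁻¹ yy′ (stay _)      (stay _)      = yy′

    Advance-side : ∀ {x y} → Advance x y → T.side y ≡ S.side x
    Advance-side (move _ path) = ⟶-side path
    Advance-side (stay ¬bad)   = sym (¬bad⇒≡ ¬bad)

    advanceAutomorphism : Γ ≃ Γ
    advanceAutomorphism = record
      { bijection = injective⇒↔ (↔⇒↣ enc) (proj₁ ∘ advance) λ {x} {y} eq →
          Advance-injective (proj₂ (advance x)) (subst (Advance y) (sym eq) (proj₂ (advance y)))
      ; adj⇔ = λ x y → mk⇔
          (λ xy → let _ , adv , x′y′ = Advance-adj xy (proj₂ (advance x)) in
                  subst (Γ.Adj _) (Advance-functional adv (proj₂ (advance y))) x′y′)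
          (λ x′y′ → Advance-adj⁻¹ x′y′ (proj₂ (advance x)) (proj₂ (advance y)))
      }

-- Alignment of two cover structures by induction on the bad set.

module _ {X : Set} {N : ℕ} (enc : X ↔ Fin N) {Γ : Graph X} (S : CoverStructure Γ) where
  open CoverStructure using (side)

  Alignment : CoverStructure Γ → Set
  Alignment T = Σ[ α ∈ Γ ≃ Γ ] ∀ x → side T (to (_≃_.bijection α) x) ≡ side S x

  -- `exchange` fixes good vertices, so they remain good. The bad vertex `x` becomes good: it takes
  -- the second colour of `y`, which is its own first colour by `⟶-side`.
  exchange-decreases : ∀ T {x y} → Meets enc S T x y →
                       badSet enc S (pullback (exchangeAutomorphism enc S T) T) ⊂ badSet enc S T
  exchange-decreases T {x} {y} m =
      (λ i∈ → ∈badSet⁺ enc S T (still-bad (∈badSet⁻ enc S T′ i∈)))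
    , to enc x
    , ∈badSet⁺ enc S T (subst (Bad enc S T) (sym (strictlyInverseʳ enc x)) (proj₁ m))
    , λ x∈ → subst (Bad enc S T′) (strictlyInverseʳ enc x) (∈badSet⁻ enc S T′ x∈) x-good
    where
    T′ = pullback (exchangeAutomorphism enc S T) T

    still-bad : ∀ {z} → Bad enc S T′ z → Bad enc S T z
    still-bad bad′ eq = bad′ (trans eq (cong (side T) (sym
      (exchange-¬Meets enc S T λ (_ , bad , _) → bad eq))))

    x-good : side S x ≡ side T′ x
    x-good = trans (sym (⟶-side enc S T (proj₂ m))) (cong (side T) (sym (exchange-Meets enc S T m)))

  alignment : ∀ T → Alignment T
  alignment T = go T (⊂-wellFounded (badSet enc S T))
    where
    go : ∀ T → Acc _⊂_ (badSet enc S T) → Alignment T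
    go T (acc rs) with any? (meets? enc S T ∘ from enc)
    ... | yes (_ , _ , m) =
      let α , aligned = go (pullback (exchangeAutomorphism enc S T) T) (rs (exchange-decreases T m))
      -- The pulled-back colouring is by definition `side T` after `exchange`, so `aligned` serves
      -- unchanged for the composite.
      in ≃-trans α (exchangeAutomorphism enc S T) , aligned
    ... | no ¬m = advanceAutomorphism enc S T ¬meets , λ x →
        Advance-side enc S T ¬meets (proj₂ (advance enc S T ¬meets x))
      where
      ¬meets : ∀ {x} → ¬ ∃ (Meets enc S T x)
      ¬meets {x} m = ¬m (to enc x , subst (∃ ∘ Meets enc S T) (sym (strictlyInverseʳ enc x)) m)

-- Two-fold isomorphisms and double coverings.

infix 4 _≃₂_

-- The two-fold isomorphisms of Lauri, Mizzi and Scapellato.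
record _≃₂_ {V W : Set} (G : Graph V) (H : Graph W) : Set where
  field
    left right : V ↔ W
    adj⇔       : ∀ u v → Graph.Adj G u v ⇔ Graph.Adj H (to left u) (to right v)

≃₂-sym : {V W : Set} {G : Graph V} {H : Graph W} → G ≃₂ H → H ≃₂ G
≃₂-sym {G = G} {H} φ = record
  { left  = ↔-sym φ.left
  ; right = ↔-sym φ.right
  ; adj⇔  = λ u v → ⇔-sym $ subst₂
      (λ a b → Graph.Adj G (from φ.left u) (from φ.right v) ⇔ Graph.Adj H a b)
      (strictlyInverseˡ φ.left u) (strictlyInverseˡ φ.right v) (φ.adj⇔ _ _)
  }
  where module φ = _≃₂_ φ

CDC-cover : {V : Set} (G : Graph V) → CoverStructure (CDC G)
CDC-cover G = record
  { side            = proj₂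
  ; swap            = λ (u , i) → u , opposite i
  ; side-proper     = λ { (edge₀₁ _) → refl ; (edge₁₀ _) → refl }
  ; swap-involutive = λ (u , i) → cong (u ,_) (opposite-involutive i)
  ; swap-adj        = λ { (edge₀₁ e) → edge₁₀ e ; (edge₁₀ e) → edge₀₁ e }
  ; side-swap       = λ _ → refl
  }

CDCAdj⇔ : {V : Set} {G : Graph V} → ∀ {u v} → Graph.Adj G u v ⇔ CDCAdj G (u , 0F) (v , 1F)
CDCAdj⇔ = mk⇔ edge₀₁ λ { (edge₀₁ e) → e }

module _ {V W : Set} {G : Graph V} {H : Graph W} where

  sidePreserving⇒≃₂ : (φ : CDC G ≃ CDC H) → (∀ x → proj₂ (to (_≃_.bijection φ) x) ≡ proj₂ x) → G ≃₂ H
  sidePreserving⇒≃₂ φ φ-side = record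
    { left  = layer 0F
    ; right = layer 1F
    ; adj⇔  = λ u v → ⇔-sym (CDCAdj⇔ {G = H}) ⇔-∘
                (subst₂ (λ x y → CDCAdj G (u , 0F) (v , 1F) ⇔ CDCAdj H x y)
                       (to-layer 0F u) (to-layer 1F v) (φ.adj⇔ _ _)
                ⇔-∘ CDCAdj⇔ {G = G})
    }
    where
    module φ = _≃_ φ
    f = to φ.bijection
    g = from φ.bijection

    to-layer : ∀ i u → f (u , i) ≡ (proj₁ (f (u , i)) , i)
    to-layer i u = cong (proj₁ (f (u , i)) ,_) (φ-side (u , i))

    from-layer : ∀ i w → g (w , i) ≡ (proj₁ (g (w , i)) , i)
    from-layer i w = cong (proj₁ (g (w , i)) ,_)
      (trans (sym (φ-side (g (w , i)))) (cong proj₂ (strictlyInverseˡ φ.bijection (w , i))))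

    layer : Fin 2 → V ↔ W
    layer i = mk↔ₛ′ (λ u → proj₁ (f (u , i))) (λ w → proj₁ (g (w , i)))
      (λ w → cong proj₁ (trans (cong f (sym (from-layer i w))) (strictlyInverseˡ φ.bijection (w , i))))
      (λ u → cong proj₁ (trans (cong g (sym (to-layer i u))) (strictlyInverseʳ φ.bijection (u , i))))

  ≃₂⇒CDC≃ : G ≃₂ H → CDC G ≃ CDC H
  ≃₂⇒CDC≃ φ = record
    { bijection = mk↔ₛ′ (λ (u , i) → to (π i) u , i) (λ (w , i) → from (π i) w , i)
        (λ (w , i) → cong (_, i) (strictlyInverseˡ (π i) w))
        (λ (u , i) → cong (_, i) (strictlyInverseʳ (π i) u))
    ; adj⇔ = λ u v → mk⇔
        (λ { (edge₀₁ e) → edge₀₁ (Equivalence.to (φ.adj⇔ _ _) e)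
           -- `φ.adj⇔` takes `left` on its first argument, so edges starting in layer 1 are turned
           -- around.
           ; (edge₁₀ e) → edge₁₀ (H.sym (Equivalence.to (φ.adj⇔ _ _) (G.sym e))) })
        (CDCAdj⁻¹ u v)
    }
    where
    module φ = _≃₂_ φ
    module G = Graph G
    module H = Graph H

    π : Fin 2 → V ↔ W
    π 0F = φ.left
    π 1F = φ.right

    CDCAdj⁻¹ : ∀ x y →
      CDCAdj H (to (π (proj₂ x)) (proj₁ x) , proj₂ x) (to (π (proj₂ y)) (proj₁ y) , proj₂ y) →
      CDCAdj G x y
    CDCAdj⁻¹ (_ , 0F) (_ , 1F) (edge₀₁ e) = edge₀₁ (Equivalence.from (φ.adj⇔ _ _) e)
    CDCAdj⁻¹ (_ , 1F) (_ , 0F) (edge₁₀ e) = edge₁₀ (G.sym (Equivalence.from (φ.adj⇔ _ _) (H.sym e)))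

CDC≃⇒≃₂ : ∀ {n} {W : Set} {G : Graph (Fin n)} {H : Graph W} → CDC G ≃ CDC H → G ≃₂ H
CDC≃⇒≃₂ {G = G} {H} φ =
  -- The second structure consists of the layers of `H` seen through `φ`, so `aligned` says that `φ`
  -- after `α` preserves layers.
  let α , aligned = alignment (↔-sym *↔×) (CDC-cover G) (pullback φ (CDC-cover H))
  in sidePreserving⇒≃₂ (≃-trans α φ) aligned

-- Permutation matrices and entries of adjacency matrices.

sum-single : ∀ {n} (f : Fin n → ℤ) k → (∀ j → j ≢ k → f j ≡ 0ℤ) → sum f ≡ f k
sum-single {suc n} f k f≡0 = begin
  sum f                           ≡⟨ sum-remove {i = k} f ⟩
  f k + sum (f ∘ punchIn k)       ≡⟨ cong (f k +_) (sum-cong-≗ λ j → f≡0 _ (punchInᵢ≢i k j)) ⟩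
  f k + sum {n} (λ _ → 0ℤ)        ≡⟨ cong (f k +_) (sum-replicate-zero n) ⟩
  f k + 0ℤ                        ≡⟨ ℤ.+-identityʳ (f k) ⟩
  f k                             ∎
  where open ≡-Reasoning

module _ {n} {P : Matrix n n} (isPerm : IsPermutationMatrix P) where
  open IsPermutationMatrix isPerm

  permutation : Fin n ↔ Fin n
  permutation = mk↔ₛ′ (proj₁ ∘ row) (proj₁ ∘ column)
    (λ j → proj₂ (proj₂ (row _)) (proj₁ (proj₂ (column j))))
    (λ i → proj₂ (proj₂ (column _)) (proj₁ (proj₂ (row i))))

  zero-off : ∀ {i j} → j ≢ to permutation i → P i j ≡ 0ℤ
  zero-off {i} {j} j≢ with zero-one i j
  ... | inj₁ P≡0 = P≡0
  ... | inj₂ P≡1 = contradiction (sym (proj₂ (proj₂ (row i)) P≡1)) j≢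

  P⊗-entry : ∀ {m} (A : Matrix n m) i k → (P ⊗ A) i k ≡ A (to permutation i) k
  P⊗-entry A i k = begin
    sum (λ j → P i j * A j k)   ≡⟨ sum-single _ σi (λ j j≢ →
                                     trans (cong (_* A j k) (zero-off j≢)) (ℤ.*-zeroˡ (A j k))) ⟩
    P i σi * A σi k             ≡⟨ cong (_* A σi k) (proj₁ (proj₂ (row i))) ⟩
    1ℤ * A σi k                 ≡⟨ ℤ.*-identityˡ (A σi k) ⟩
    A σi k                      ∎
    where
    open ≡-Reasoning
    σi = to permutation i

  ⊗P-entry : ∀ {m} (A : Matrix m n) i k → (A ⊗ P) i k ≡ A i (from permutation k)
  ⊗P-entry A i k = begin
    sum (λ j → A i j * P j k)   ≡⟨ sum-single _ τk (λ j j≢ →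
                                     trans (cong (A i j *_) (zero-off (j≢ ∘ inverse j))) (ℤ.*-zeroʳ (A i j))) ⟩
    A i τk * P τk k             ≡⟨ cong (A i τk *_) (proj₁ (proj₂ (column k))) ⟩
    A i τk * 1ℤ                 ≡⟨ ℤ.*-identityʳ (A i τk) ⟩
    A i τk                      ∎
    where
    open ≡-Reasoning
    τk = from permutation k

    inverse : ∀ j → k ≡ to permutation j → j ≡ τk
    inverse j refl = sym (strictlyInverseʳ permutation j)

permutationMatrix : ∀ {n} → Fin n ↔ Fin n → Matrix n n
permutationMatrix π i j = if does (to π i ≟ j) then 1ℤ else 0ℤ

isPermutationMatrix : ∀ {n} (π : Fin n ↔ Fin n) → IsPermutationMatrix (permutationMatrix π)
isPermutationMatrix π = record
  { zero-one = zero-one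
  ; row      = λ i → to π i , on refl , off
  ; column   = λ j → from π j , on (strictlyInverseˡ π j) ,
                     λ eq → trans (cong (from π) (sym (off eq))) (strictlyInverseʳ π _)
  }
  where
  zero-one : ∀ i j → permutationMatrix π i j ≡ 0ℤ ⊎ permutationMatrix π i j ≡ 1ℤ
  zero-one i j with does (to π i ≟ j)
  ... | true  = inj₂ refl
  ... | false = inj₁ refl

  on : ∀ {i j} → to π i ≡ j → permutationMatrix π i j ≡ 1ℤ
  on {i} {j} eq = cong (if_then 1ℤ else 0ℤ) (dec-true (to π i ≟ j) eq)

  off : ∀ {i j} → permutationMatrix π i j ≡ 1ℤ → to π i ≡ j
  off {i} {j} eq with to π i ≟ j
  ... | yes p = p

adjacencyMatrix-≡⇔ : ∀ {n m} (G : Graph (Fin n)) (H : Graph (Fin m)) {i j k l} →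
  adjacencyMatrix G i j ≡ adjacencyMatrix H k l ⇔ (Graph.Adj G i j ⇔ Graph.Adj H k l)
adjacencyMatrix-≡⇔ G H {i} {j} {k} {l} = mk⇔ entries⇒ entries⇐
  where
  entries⇒ : adjacencyMatrix G i j ≡ adjacencyMatrix H k l → Graph.Adj G i j ⇔ Graph.Adj H k l
  entries⇒ eq with Graph.adj? G i j | Graph.adj? H k l
  ... | yes ij | yes kl = mk⇔ (λ _ → kl) (λ _ → ij)
  ... | no ¬ij | no ¬kl = mk⇔ (λ ij → contradiction ij ¬ij) (λ kl → contradiction kl ¬kl)

  entries⇐ : Graph.Adj G i j ⇔ Graph.Adj H k l → adjacencyMatrix G i j ≡ adjacencyMatrix H k l
  entries⇐ eq = cong (if_then 1ℤ else 0ℤ) (does-⇔ eq (Graph.adj? G i j) (Graph.adj? H k l))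

module _ {n} {Q R : Matrix n n} (isQ : IsPermutationMatrix Q) (isR : IsPermutationMatrix R) where

  Q⊗A⊗R-entry : ∀ A i j → (Q ⊗ A ⊗ R) i j ≡ A (to (permutation isQ) i) (from (permutation isR) j)
  Q⊗A⊗R-entry A i j = trans (⊗P-entry isR (Q ⊗ A) i j) (P⊗-entry isQ A i _)

-- The matrix equation as a two-fold isomorphism.

module _ {n m} {G : Graph (Fin n)} {H : Graph (Fin m)} where

  ≃₂⇒matrices : G ≃₂ H →
    Σ[ Q ∈ Matrix n n ] Σ[ R ∈ Matrix n n ]
      (IsPermutationMatrix Q × IsPermutationMatrix R × (Q ⊗ adjacencyMatrix G ⊗ R ≐ adjacencyMatrix H))
  ≃₂⇒matrices φ with refl ← ↔⇒≡ (_≃₂_.left φ) =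
      -- Left multiplication applies the permutation of `Q` to row indices, right multiplication the
      -- inverse of that of `R` to column indices. Both index maps must be inverses, so only `left`
      -- is inverted here.
      permutationMatrix (↔-sym φ.left) , permutationMatrix φ.right , isQ , isR , refl , refl , λ i j →
      trans (Q⊗A⊗R-entry isQ isR (adjacencyMatrix G) i j)
        (Equivalence.from (adjacencyMatrix-≡⇔ G H) (subst₂
          (λ k l → Graph.Adj G (from φ.left i) (from φ.right j) ⇔ Graph.Adj H k l)
          (trans (strictlyInverseˡ φ.left i) (sym (cast-is-id refl i)))
          (trans (strictlyInverseˡ φ.right j) (sym (cast-is-id refl j)))
          (φ.adj⇔ _ _)))
    where
    module φ = _≃₂_ φ
    isQ = isPermutationMatrix (↔-sym φ.left)
    isR = isPermutationMatrix φ.right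

  matrices⇒≃₂ : ∀ {Q R} → IsPermutationMatrix Q → IsPermutationMatrix R →
                Q ⊗ adjacencyMatrix G ⊗ R ≐ adjacencyMatrix H → G ≃₂ H
  -- The entry formula sends indices of `H` to indices of `G`, so the isomorphism arises from `H` to
  -- `G` and is then inverted.
  matrices⇒≃₂ isQ isR (refl , eq , entries) = ≃₂-sym record
    { left  = permutation isQ
    ; right = ↔-sym (permutation isR)
    ; adj⇔  = λ i j → ⇔-sym (Equivalence.to (adjacencyMatrix-≡⇔ G H)
        (trans (sym (Q⊗A⊗R-entry isQ isR (adjacencyMatrix G) i j))
          (trans (entries i j) (cong₂ (adjacencyMatrix H) (cast-is-id refl i) (cast-is-id eq j)))))
    }

theorem4p2 : ∀ (n m : ℕ) (G : Graph (Fin n)) (H : Graph (Fin m)) →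
    (CDC G ≃ CDC H) ⇔
    (Σ[ Q ∈ Matrix n n ] Σ[ R ∈ Matrix n n ]
    (IsPermutationMatrix Q × IsPermutationMatrix R ×
    (Q ⊗ adjacencyMatrix G ⊗ R ≐ adjacencyMatrix H)))
theorem4p2 n m G H = mk⇔ (≃₂⇒matrices ∘ CDC≃⇒≃₂)
  λ (_ , _ , isQ , isR , eq) → ≃₂⇒CDC≃ (matrices⇒≃₂ isQ isR eq)
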